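{- For each integer $n\geq 1$ and each Mostowski-Rabin index $(\iota,\kappa)$ such that $(0,2)\sqsubseteq(\iota,\kappa)$ or $(\iota,\kappa)=(1,3)=\overline{(0,2)}$, the $D_{\omega^n}(\boldsymbol{\Sigma}^1_1)$-complete tree language $\mathcal{L}_n$ is Wadge reducible to the game tree language $W_{(\iota,\kappa)}$, i.e. $\mathcal{L}_n\leq_W W_{(\iota,\kappa)}$. In particular, the language $W_{(\iota,\kappa)}$ is not in any class $D_\alpha(\boldsymbol{\Sigma}^1_1)$ for $\alpha<\omega^\omega$.
   Context: **Trees.** For a finite alphabet $\Sigma$, $T_\Sigma^\omega$ is the set of all functions $t:\{l,r\}^\star\to\Sigma$ (infinite binary trees labelled in $\Sigma$; the root is the empty word $\lambda$). For $u\in\{l,r\}^\star$, $t_u\in T_\Sigma^\omega$ is the subtree $t_u(v)=t(u\cdot v)$. A path of $t$ is an infinite sequence $t(u_0)t(u_1)\cdots$ of labels along an infinite branch, where $u_0=\lambda$ and $u_{i+1}\in\{u_il,u_ir\}$ for all $i$. **Topology.** $\Sigma^\omega$ (infinite words) and $T_\Sigma^\omega$ carry the Cantor (product of discrete) topology. $\boldsymbol{\Sigma}^1_1$ is the class of analytic sets. **Difference hierarchy.** A countable ordinal is even if it is of the form $\gamma+m$ with $\gamma$ equal to $0$ or a limit ordinal and $m$ an even non-negative integer; otherwise it is odd. For an ordinal $\eta<\omega_1$ and an increasing sequence $(A_\theta)_{\theta<\eta}$ of subsets of a space $X$, $D_\eta[(A_\theta)_{\theta<\eta}]$ is the set of $x\in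 X$ such that $x\in A_\theta\setminus\bigcup_{\theta'<\theta}A_{\theta'}$ for some $\theta<\eta$ whose parity is opposite to that of $\eta$. For $X=\Sigma^\omega$ or $X=T_\Sigma^\omega$, $D_\eta(\boldsymbol{\Sigma}^1_1)$ is the class of all sets $D_\eta[(A_\theta)_{\theta<\eta}]$ with every $A_\theta\subseteq X$ in $\boldsymbol{\Sigma}^1_1$. **Reducibility and completeness.** $E\leq_W F$ (Wadge reducibility) means $E=f^{ -1}(F)$ for some continuous function $f$ between the ambient spaces. A set $F$ (in a space $\Sigma^\omega$ or $T_\Sigma^\omega$) is $D_\eta(\boldsymbol{\Sigma}^1_1)$-complete if for every finite alphabet $Y$ and every $E\subseteq Y^\omega$: $E\in D_\eta(\boldsymbol{\Sigma}^1_1)$ iff $E\leq_W F$. **The languages $\mathcal{L}$ and $\mathcal{L}_n$.** $\mathcal{L}\subseteq T^\omega_{\{0,1\}}$ is the set of trees having at least one path containing infinitely many letters $1$. For non-negative integers write $\mathrm{Ord}(a_{n-1},\ldots,a_0)=\omega^{n-1}\cdot a_{n-1}+\cdots+\omega\cdot a_1+a_0$. For $n=1$, $$\mathcal{L}_1=\{t\in T^\omega_{\{0,1\}}\mid \exists m\geq 0\ \ t_{l^m\cdot r}\in\mathcal{L}\text{ and }\min\{m\geq 0\mid t_{l^m\cdot r}\in\mathcal{L}\}\text{ is odd}\}.$$ For $n\geq 2$, $\mathcal{L}_n$ is the set of $t\in T^\omega_{\{0,1\}}$ for which there exist integers $a_{n-1},\ldots,a_0\geq 0$ such that: (1) $t_{l^{a_{n-1}}\cdot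 r\cdot l^{a_{n-2}}\cdot r\cdots l^{a_0}\cdot r}\in\mathcal{L}$ and $\mathrm{Ord}(a_{n-1},\ldots,a_0)$ is odd; (2) for all integers $b_{n-1},\ldots,b_0\ge 0$ with $\mathrm{Ord}(b_{n-1},\ldots,b_0)<\mathrm{Ord}(a_{n-1},\ldots,a_0)$, the tree $t_{l^{b_{n-1}}\cdot r\cdot l^{b_{n-2}}\cdot r\cdots l^{b_0}\cdot r}$ is not in $\mathcal{L}$. **Mostowski-Rabin indices.** A Mostowski-Rabin index is a pair $(\iota,\kappa)$ with $\iota\in\{0,1\}$ and $\iota\leq\kappa<\omega$. The partial order is: $(\iota,\kappa)\sqsubseteq(\iota',\kappa')$ iff either $\iota'\leq\iota$ and $\kappa\leq\kappa'$, or $\iota=0$, $\iota'=1$ and $\kappa+2\leq\kappa'$. The indices $(1,m)$ and $(0,m-1)$ are dual to each other, and $\overline{(\iota,\kappa)}$ denotes the dual of $(\iota,\kappa)$. **Game tree languages $W_{(\iota,\kappa)}$.** Let $\Sigma_{(\iota,\kappa)}=\{\exists,\forall\}\times\{\iota,\ldots,\kappa\}$; for a letter $a$ write $a=(a_1,a_2)$. For $t\in T^\omega_{\Sigma_{(\iota,\kappa)}}$, the parity game $G(t)$ is played by Eve and Adam with positions $v\in\{l,r\}^\star$, starting at $\lambda$. At position $v$, Eve moves if $t(v)_1=\exists$ and Adam moves if $t(v)_1=\forall$; a move goes from $v$ to $vl$ or $vr$. Eve wins an infinite play $v_0,v_1,\ldots$ iff $\limsup_{k\to\infty}t(v_k)_2$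 is even; otherwise Adam wins. $W_{(\iota,\kappa)}\subseteq T^\omega_{\Sigma_{(\iota,\kappa)}}$ is the set of trees $t$ such that Eve has a winning strategy in $G(t)$. -}

module Defs where

open import Data.Fin.Base using (Fin; toℕ)
open import Data.Fin.Patterns using (0F; 1F)
open import Data.List.Base using (List; []; _∷_; [_]; _++_; _∷ʳ_; replicate)
open import Data.List.Relation.Unary.All using (All)
open import Data.Nat.Base using (ℕ; zero; suc; _+_; _≤_; _<_; z≤n; s≤s; parity)
open import Data.Nat.Divisibility using (_∣_)
open import Data.Parity.Base using (Parity; 0ℙ; 1ℙ; _⁻¹)
open import Data.Product.Base using (Σ-syntax; ∃; ∃-syntax; _×_; _,_; proj₁; proj₂)
open import Data.Sum.Base using (_⊎_)
open import Data.Vec.Base as Vec using (Vec; []; _∷_)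
open import Data.Vec.Relation.Binary.Lex.Strict using (Lex-<)
open import Function.Base using (_∘_)
open import Function.Bundles using (_⇔_; _↔_)
open import Level using (0ℓ)
open import Relation.Binary.PropositionalEquality.Core using (_≡_; refl)
open import Relation.Nullary.Negation.Core using (¬_)
open import Relation.Unary using (Pred; _∈_; _∉_; _⊆_; _≐_)

------------------------------------------------------------------------
-- Words and trees

data Dir : Set where
  l r : Dir

-- A word is read from the root: its first letter is the first step.
Word : Set
Word = List Dir

_^ω : Set → Set
A ^ω = ℕ → A

Tree : Set → Set
Tree A = Word → A

subtree : {A : Set} → Word → Tree A → Tree A
subtree u t v = t (u ++ v)

-- The sequence of nodes u₀, u₁, … of an infinite branch.
IsBranch : (ℕ → Word) → Set
IsBranch u = u 0 ≡ [] × (∀ i → u (suc i) ≡ u i ∷ʳ l ⊎ u (suc i) ≡ u i ∷ʳ r)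

------------------------------------------------------------------------
-- Topology
--
-- A ^ω and Tree A are both of the form I → A with I countable, and are
-- treated uniformly.  A basic neighbourhood of x in the product topology
-- consists of the points that agree with x on a finite list of
-- coordinates.

Subset : Set → Set → Set₁
Subset I A = Pred (I → A) 0ℓ

infix 4 _≈[_]_

_≈[_]_ : {I A : Set} → (I → A) → List I → (I → A) → Set
x ≈[ F ] y = All (λ i → x i ≡ y i) F

Continuous : {I A J B : Set} → ((I → A) → (J → B)) → Set
Continuous {I} f =
  ∀ x j → Σ[ F ∈ List I ] (∀ y → x ≈[ F ] y → f x j ≡ f y j)

-- The complement is open in the product of the two spaces.
Closed₂ : {I A J B : Set} → ((I → A) → (J → B) → Set) → Set
Closed₂ {I} {A} {J} {B} C =
  ∀ x y → ¬ C x y →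
  Σ[ F ∈ List I ] Σ[ G ∈ List J ]
    (∀ x′ y′ → x ≈[ F ] x′ → y ≈[ G ] y′ → ¬ C x′ y′)

-- Analytic sets as the projections of closed subsets of X × ℕ^ω.
Analytic : {I A : Set} → Subset I A → Set₁
Analytic {I} {A} E =
  Σ[ C ∈ ((I → A) → ℕ ^ω → Set) ] Closed₂ C × E ≐ (λ x → ∃[ y ] C x y)

infix 4 _≤W_

_≤W_ : {I A J B : Set} → Subset I A → Subset J B → Set
_≤W_ {I} {A} {J} {B} E F =
  Σ[ f ∈ ((I → A) → (J → B)) ] Continuous f × E ≐ (λ x → f x ∈ F)

------------------------------------------------------------------------
-- Ordinals below ω^ω
--
-- By Cantor normal form, the vector (aₙ₋₁ , … , a₀), highest coefficient
-- first, stands for the ordinal ω^(n-1)·aₙ₋₁ + … + ω·a₁ + a₀.  So Ord n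
-- with its strict lexicographic order is the ordinal ω^n, i.e. the set of
-- ordinals below ω^n.  Leading zeros do not change the ordinal.

Ord : ℕ → Set
Ord n = Vec ℕ n

infix 4 _≺_

_≺_ : {n : ℕ} → Ord n → Ord n → Set
_≺_ = Lex-< _≡_ _<_

-- In γ + m with γ zero or a limit and m finite, m is the last coefficient.
ordParity : {n : ℕ} → Ord n → Parity
ordParity []               = 0ℙ
ordParity (a ∷ [])         = parity a
ordParity (_ ∷ as@(_ ∷ _)) = ordParity as

ω^ : (n : ℕ) → Ord (suc n)
ω^ n = 1 ∷ Vec.replicate n 0

------------------------------------------------------------------------
-- The difference hierarchy over the analytic sets

-- Only the values A θ with θ ≺ η are relevant, here and in D.
Diff : {I A : Set} {n : ℕ} (η : Ord n) → (Ord n → Subset I A) → Subset I A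
Diff η A x =
  ∃[ θ ] θ ≺ η
       × ordParity θ ≡ (ordParity η) ⁻¹
       × x ∈ A θ
       × (∀ θ′ → θ′ ≺ θ → x ∉ A θ′)

D : {I A : Set} {n : ℕ} → Ord n → Subset I A → Set₁
D {I} {A} {n} η E =
  Σ[ S ∈ (Ord n → Subset I A) ]
      (∀ θ → θ ≺ η → Analytic (S θ))
    × (∀ θ θ′ → θ ≺ η → θ′ ≺ θ → S θ′ ⊆ S θ)
    × E ≐ Diff η S

D-Complete : {I A : Set} {n : ℕ} → Ord n → Subset I A → Set₁
D-Complete η F =
  ∀ (Y : Set) (k : ℕ) → Y ↔ Fin k →
  ∀ (E : Subset ℕ Y) → D η E ⇔ E ≤W F

------------------------------------------------------------------------
-- The languages 𝓛 and 𝓛ₙ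

𝓛 : Subset Word (Fin 2)
𝓛 t = ∃[ u ] IsBranch u × (∀ N → ∃[ k ] N ≤ k × t (u k) ≡ 1F)

-- l^aₙ₋₁ · r · l^aₙ₋₂ · r ⋯ l^a₀ · r
address : {n : ℕ} → Ord n → Word
address []       = []
address (a ∷ as) = replicate a l ++ r ∷ address as

-- For n = 1 this says that the least m with t_(l^m·r) ∈ 𝓛 exists and is
-- odd.
𝓛[_] : ℕ → Subset Word (Fin 2)
𝓛[ n ] t =
  Σ[ a ∈ Ord n ]
      (subtree (address a) t ∈ 𝓛 × ordParity a ≡ 1ℙ)
    × (∀ (b : Ord n) → b ≺ a → subtree (address b) t ∉ 𝓛)

------------------------------------------------------------------------
-- Mostowski–Rabin indices

record MRIndex : Set where
  constructor index
  field
    ι    : Fin 2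
    κ    : ℕ
    .ι≤κ : toℕ ι ≤ κ

open MRIndex public using (ι; κ)

infix 4 _⊑_

_⊑_ : MRIndex → MRIndex → Set
i ⊑ j = (toℕ (ι j) ≤ toℕ (ι i) × κ i ≤ κ j)
      ⊎ (ι i ≡ 0F × ι j ≡ 1F × κ i + 2 ≤ κ j)

dual : MRIndex → MRIndex
dual (index 0F κ       _) = index 1F (suc κ) (s≤s z≤n)
dual (index 1F (suc κ) _) = index 0F κ z≤n

⟨0,2⟩ ⟨1,3⟩ : MRIndex
⟨0,2⟩ = index 0F 2 z≤n
⟨1,3⟩ = index 1F 3 (s≤s z≤n)

⟨1,3⟩≡dual⟨0,2⟩ : ⟨1,3⟩ ≡ dual ⟨0,2⟩
⟨1,3⟩≡dual⟨0,2⟩ = refl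

------------------------------------------------------------------------
-- Game tree languages

data Player : Set where
  Eve Adam : Player

Letter : MRIndex → Set
Letter i = Player × (Σ[ p ∈ ℕ ] toℕ (ι i) ≤ p × p ≤ κ i)

player : {i : MRIndex} → Letter i → Player
player = proj₁

priority : {i : MRIndex} → Letter i → ℕ
priority = proj₁ ∘ proj₂

IsLimsup : (ℕ → ℕ) → ℕ → Set
IsLimsup s p = (∃[ N ] (∀ k → N ≤ k → s k ≤ p))
             × (∀ N → ∃[ k ] N ≤ k × p ≤ s k)

-- A position v determines the play leading to it, so a strategy is a
-- function of the current position; its values at Adam's positions are
-- never used.
Strategy : Set
Strategy = Word → Dir

module _ {i : MRIndex} (t : Tree (Letter i)) where

  EveWins : (ℕ → Word) → Set
  EveWins v = ∃[ p ] IsLimsup (λ k → priority {i} (t (v k))) p × 2 ∣ p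

  EveFollows : Strategy → (ℕ → Word) → Set
  EveFollows σ v =
    ∀ k → player {i} (t (v k)) ≡ Eve → v (suc k) ≡ v k ∷ʳ σ (v k)

  EveWinning : Strategy → Set
  EveWinning σ = ∀ v → IsBranch v → EveFollows σ v → EveWins v

W : (i : MRIndex) → Subset Word (Letter i)
W i t = ∃ (EveWinning {i} t)

{-# OPTIONS --safe #-}

-- Two players and countably many trees t θ give a game: one player names θ and the other either
-- lets him prove t θ ∈ 𝓛 or names some θ′ ≺ θ and proves t θ′ ∈ 𝓛.  The first player wins iff the
-- least θ with t θ ∈ 𝓛 is one he was allowed to name.  Naming is done along a spine l^k·r, where
-- never leaving the spine loses, and a proof of membership is a path on which a priority good for
-- the prover recurs, so three consecutive priorities suffice.  With Eve moving first and odd θ this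
-- reduces 𝓛[ n ] to W i.
--
-- 𝓛 is complete for the analytic sets: a path spells out y ∈ ℕ^ω block by block, and a node is
-- labelled 1 iff the neighbourhoods of x and y determined so far meet the closed set.  Each label
-- depends only on the part of x above the node.  Hence, if W i were a difference of analytic sets
-- S θ, the game in which Adam proves that a tree lies in that difference would be a causal function
-- of the tree; at its fixed point, Eve wins iff Adam does.
module Submission where

open import Defs
open import Axiom.ExcludedMiddle using (ExcludedMiddle)
open import Data.Fin.Base using (Fin; toℕ)
open import Data.Fin.Patterns using (0F; 1F)
open import Data.List.Base using (List; []; _∷_; [_]; _++_; _∷ʳ_; length; applyUpTo; upTo; replicate)
open import Data.List.Membership.Propositional.Properties using (∈-upTo⁺)
open import Data.List.Relation.Unary.All as All using ([]; _∷_)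
import Data.List.Relation.Unary.All.Properties as All
open import Data.List.Properties using (applyUpTo-∷ʳ; length-applyUpTo; length-++; ∷-injective; ∷ʳ-injectiveʳ)
open import Data.Nat.Base using (ℕ; zero; suc; _+_; _≤_; _<_; _⊔_; z≤n; s≤s; z<s; s<s)
open import Data.Nat.Divisibility using (_∣_; _∣?_; _∣0; ∣-refl)
open import Data.Nat.Properties
  using (≤-refl; ≤-reflexive; ≤-trans; ≤-antisym; <-trans; <-resp₂-≡; <⇒≤; m≤n⇒m≤1+n;
         m≤m⊔n; m≤n⊔m; m≤m+n; m≤n+m; +-identityʳ; +-suc)
open import Data.Parity.Base using (0ℙ; 1ℙ; _⁻¹)
open import Data.Product.Base using (∃; ∃-syntax; Σ-syntax; _×_; _,_; proj₁; proj₂)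
open import Data.Sum.Base using (_⊎_; inj₁; inj₂)
open import Data.Vec.Base as Vec using ([]; _∷_)
open import Data.Vec.Relation.Binary.Lex.Strict as Lex using (base; this; next)
open import Function.Base using (_∘_; id; case_of_)
open import Function.Bundles using (_⇔_; mk⇔; Equivalence)
open import Level using (0ℓ)
open import Relation.Binary.PropositionalEquality.Core using (_≡_; _≢_; refl; sym; trans; cong; cong₂; subst)
open import Relation.Binary.PropositionalEquality.Properties using () renaming (isEquivalence to ≡-isEquivalence)
open import Relation.Binary.Structures using (IsEquivalence)
open import Relation.Nullary.Decidable.Core using (Dec; yes; no; from-no)
open import Relation.Nullary.Negation.Core using (¬_; contradiction)
open import Relation.Unary using (Pred; _∈_; _∉_; _⊆_)

open Equivalence using (to; from)

private
  variable
    A B I : Set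
    n : ℕ

-- Branches as sequences of directions

applyUpTo-cong : {f g : ℕ → A} (k : ℕ) → (∀ i → i < k → f i ≡ g i) → applyUpTo f k ≡ applyUpTo g k
applyUpTo-cong zero    e = refl
applyUpTo-cong (suc k) e = cong₂ _∷_ (e 0 z<s) (applyUpTo-cong k (λ i i<k → e (suc i) (s<s i<k)))

branch-directions : ∀ {u} → IsBranch u → ∃[ δ ] (∀ k → u k ≡ applyUpTo δ k)
branch-directions {u} (root , step) = δ , along
  where
  δ : ℕ → Dir
  δ k with step k
  ... | inj₁ _ = l
  ... | inj₂ _ = r

  step-δ : ∀ k → u (suc k) ≡ u k ∷ʳ δ k
  step-δ k with step k
  ... | inj₁ e = e
  ... | inj₂ e = e

  along : ∀ k → u k ≡ applyUpTo δ k
  along zero    = root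
  along (suc k) = trans (step-δ k) (trans (cong (_∷ʳ δ k) (along k)) (applyUpTo-∷ʳ δ k))

snoc-branch : ∀ {u} (δ : ℕ → Dir) → u 0 ≡ [] → (∀ k → u (suc k) ≡ u k ∷ʳ δ k) → IsBranch u
snoc-branch {u} δ root step = root , λ k → by-direction (δ k) (step k)
  where
  by-direction : ∀ {v w} d → v ≡ w ∷ʳ d → v ≡ w ∷ʳ l ⊎ v ≡ w ∷ʳ r
  by-direction l e = inj₁ e
  by-direction r e = inj₂ e

directions-branch : (δ : ℕ → Dir) → IsBranch (applyUpTo δ)
directions-branch δ = snoc-branch δ refl (λ k → sym (applyUpTo-∷ʳ δ k))

Frequently : Pred ℕ 0ℓ → Set
Frequently P = ∀ N → ∃[ k ] N ≤ k × P k

Accepts : Tree (Fin 2) → (ℕ → Dir) → Set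
Accepts t δ = Frequently (λ k → t (applyUpTo δ k) ≡ 1F)

𝓛⇔ : ∀ t → t ∈ 𝓛 ⇔ (∃[ δ ] Accepts t δ)
𝓛⇔ t = mk⇔ to′ (λ (δ , acc) → applyUpTo δ , directions-branch δ , acc)
  where
  to′ : t ∈ 𝓛 → ∃[ δ ] Accepts t δ
  to′ (u , branch , acc) with branch-directions branch
  ... | δ , e = δ , λ N → let k , N≤k , one = acc N in k , N≤k , subst (λ w → t w ≡ 1F) (e k) one

𝓛-resp : ∀ {t t′} → (∀ w → t w ≡ t′ w) → t ∈ 𝓛 → t′ ∈ 𝓛
𝓛-resp e (u , branch , acc) =
  u , branch , λ N → let k , N≤k , one = acc N in k , N≤k , trans (sym (e (u k))) one

blank : Tree (Fin 2)
blank _ = 0F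

blank∉𝓛 : blank ∉ 𝓛
blank∉𝓛 (u , branch , acc) with acc 0
... | _ , _ , ()

-- Limits superior

IsLimsup-cong : ∀ {s s′ p} → (∀ k → s k ≡ s′ k) → IsLimsup s p → IsLimsup s′ p
IsLimsup-cong e ((N , ub) , freq) =
  (N , λ k N≤k → subst (_≤ _) (e k) (ub k N≤k)) ,
  λ M → let k , M≤k , le = freq M in k , M≤k , subst (_ ≤_) (e k) le

IsLimsup-tail⁺ : ∀ {s p} → IsLimsup s p → IsLimsup (s ∘ suc) p
IsLimsup-tail⁺ {s} {p} ((N , ub) , freq) = (N , λ k N≤k → ub (suc k) (m≤n⇒m≤1+n N≤k)) , freq′
  where
  freq′ : Frequently (λ k → p ≤ s (suc k))
  freq′ M with freq (suc M)
  ... | suc k , s≤s M≤k , le = k , M≤k , le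

IsLimsup-tail⁻ : ∀ {s p} → IsLimsup (s ∘ suc) p → IsLimsup s p
IsLimsup-tail⁻ {s} {p} ((N , ub) , freq) = (suc N , ub′) , freq′
  where
  ub′ : ∀ k → suc N ≤ k → s k ≤ p
  ub′ (suc k) (s≤s N≤k) = ub k N≤k

  freq′ : Frequently (λ k → p ≤ s k)
  freq′ M with freq M
  ... | k , M≤k , le = suc k , m≤n⇒m≤1+n M≤k , le

IsLimsup-unique : ∀ {s p q} → IsLimsup s p → IsLimsup s q → p ≡ q
IsLimsup-unique a b = ≤-antisym (below a b) (below b a)
  where
  below : ∀ {s p q} → IsLimsup s p → IsLimsup s q → p ≤ q
  below (_ , freq) ((N , ub) , _) = let k , N≤k , le = freq N in ≤-trans le (ub k N≤k)

-- Spines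

-- Below l^k·r the tree is f k; the nodes l^k are labelled a.
spine : A → (ℕ → Tree A) → Tree A
spine a f []      = a
spine a f (l ∷ w) = spine a (f ∘ suc) w
spine a f (r ∷ w) = f 0 w

-- Nested spines name the coefficients of an ordinal one at a time, highest first, in the order in
-- which `address` spells them.
fan : A → (Ord n → Tree A) → Tree A
fan {n = zero}  a f = f []
fan {n = suc n} a f = spine a (λ k → fan a (f ∘ (k ∷_)))

spine-exit : (a : A) (f : ℕ → Tree A) (k : ℕ) (w v : Word) →
             spine a f ((replicate k l ++ r ∷ w) ++ v) ≡ f k (w ++ v)
spine-exit a f zero    w v = refl
spine-exit a f (suc k) w v = spine-exit a (f ∘ suc) k w v

fan-address : (a : A) (f : Ord n → Tree A) (θ : Ord n) (v : Word) → fan a f (address θ ++ v) ≡ f θ v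
fan-address a f []      v = refl
fan-address a f (k ∷ θ) v = trans (spine-exit a _ k (address θ) v) (fan-address a (f ∘ (k ∷_)) θ v)

spine-cong : (g : A → B) (a : A) {f : ℕ → Tree A} {f′ : ℕ → Tree B} →
             (∀ k w → g (f k w) ≡ f′ k w) → ∀ w → g (spine a f w) ≡ spine (g a) f′ w
spine-cong g a e []      = refl
spine-cong g a e (l ∷ w) = spine-cong g a (e ∘ suc) w
spine-cong g a e (r ∷ w) = e 0 w

fan-cong : (g : A → B) (a : A) {f : Ord n → Tree A} {f′ : Ord n → Tree B} →
           (∀ θ w → g (f θ w) ≡ f′ θ w) → ∀ w → g (fan a f w) ≡ fan (g a) f′ w
fan-cong {n = zero}  g a e = e []
fan-cong {n = suc n} g a e = spine-cong g a (λ k → fan-cong g a (λ θ → e (k ∷ θ)))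

-- Side conditions and least indices

_when_ : {Q : Set} → Tree (Fin 2) → Dec Q → Tree (Fin 2)
t when yes _ = t
t when no  _ = blank

-- As `blank` is outside `𝓛`, a condition on indices can be built into the tree whose membership is
-- to be proved.
when-𝓛 : {Q : Set} {t : Tree (Fin 2)} (d : Dec Q) → (t when d) ∈ 𝓛 ⇔ (Q × t ∈ 𝓛)
when-𝓛 (yes q) = mk⇔ (q ,_) proj₂
when-𝓛 (no ¬q) = mk⇔ (λ w → contradiction w blank∉𝓛) (λ (q , _) → contradiction q ¬q)

-- The least element of `P` exists and lies in `G`: the common shape of `𝓛[ n ]` and `Diff`.
First : Pred (Ord n) 0ℓ → Pred (Ord n) 0ℓ → Set
First G P = ∃[ θ ] θ ∈ G × θ ∈ P × (∀ θ′ → θ′ ≺ θ → θ′ ∉ P)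

Odd : Pred (Ord n) 0ℓ
Odd θ = ordParity θ ≡ 1ℙ

-- Continuity and causality

-- How the label of a node may depend on a point of X: `continuity` and `causality` are the instances.
record Locality (X : Set) : Set₁ where
  field
    Local  : {B : Set} → Word → (X → B) → Set
    const  : {B : Set} {w : Word} (b : B) → Local w (λ _ → b)
    -- Hanging a tree below a spine makes its nodes longer, and a longer node may depend on more.
    extend : {B : Set} {w : Word} {d : Dir} {g : X → B} → Local w g → Local (d ∷ w) g
    map    : {B C : Set} {w : Word} (h : B → C) {g : X → B} → Local w g → Local w (h ∘ g)

  OnTrees : (X → Tree B) → Set
  OnTrees f = ∀ w → Local w (λ x → f x w)

  spine-local : {a : B} {f : X → ℕ → Tree B} → (∀ k → OnTrees (λ x → f x k)) → OnTrees (λ x → spine a (f x))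
  spine-local h []      = const _
  spine-local h (l ∷ w) = extend (spine-local (h ∘ suc) w)
  spine-local h (r ∷ w) = extend (h 0 w)

  fan-local : {a : B} {f : X → Ord n → Tree B} → (∀ θ → OnTrees (λ x → f x θ)) → OnTrees (λ x → fan a (f x))
  fan-local {n = zero}  h = h []
  fan-local {n = suc n} h = spine-local (λ k → fan-local (λ θ → h (k ∷ θ)))

  when-local : {Q : Set} {t : X → Tree (Fin 2)} (d : Dec Q) → OnTrees t → OnTrees (λ x → t x when d)
  when-local (yes _) h = h
  when-local (no _)  h = λ _ → const 0F

continuity : {I A : Set} → Locality (I → A)
continuity {I} {A} = record
  { Local  = λ _ g → ∀ x → Σ[ F ∈ List I ] (∀ y → x ≈[ F ] y → g x ≡ g y)
  ; const  = λ _ _ → [] , λ _ _ → refl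
  ; extend = λ loc → loc
  ; map    = λ h loc x → let F , e = loc x in F , λ y x≈y → cong h (e y x≈y)
  }

AgreeBelow : (I → ℕ) → ℕ → (I → A) → (I → A) → Set
AgreeBelow rank k x y = ∀ i → rank i < k → x i ≡ y i

-- The inequality is strict: a label depends on no coordinate whose rank equals the depth of its
-- node. This gives causal functions from trees to trees a fixed point.
causality : (I → ℕ) → Locality (I → A)
causality rank = record
  { Local  = λ w g → ∀ x y → AgreeBelow rank (length w) x y → g x ≡ g y
  ; const  = λ _ _ _ _ → refl
  ; extend = λ loc x y agree → loc x y (λ i i<w → agree i (m≤n⇒m≤1+n i<w))
  ; map    = λ h loc x y agree → cong h (loc x y agree)
  }

causal⇒continuous : {f : A ^ω → Tree B} → Locality.OnTrees (causality id) f → Continuous f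
causal⇒continuous h x w = upTo (length w) , λ y x≈y → h w x y λ i i<w → All.lookup x≈y (∈-upTo⁺ i<w)

-- Under iteration of `Φ` from any point, coordinate `i` is constant after `suc (rank i)` steps,
-- because `Φ` computes it from coordinates of smaller rank.
causal-fixpoint : (rank : I → ℕ) (Φ : (I → A) → I → A) → (I → A) →
                  (∀ x y i → AgreeBelow rank (rank i) x y → Φ x i ≡ Φ y i) →
                  ∃[ x ] (∀ i → x i ≡ Φ x i)
causal-fixpoint {I} {A} rank Φ x₀ causal = (λ i → iterate (suc (rank i)) i) ,
  λ i → causal _ _ i λ j j<i → stable _ _ j j<i ≤-refl
  where
  iterate : ℕ → I → A
  iterate zero    = x₀
  iterate (suc k) = Φ (iterate k)

  stable : ∀ k m i → rank i < k → rank i < m → iterate k i ≡ iterate m i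
  stable (suc k) (suc m) i (s≤s i≤k) (s≤s i≤m) =
    causal _ _ i λ j j<i → stable k m j (≤-trans j<i i≤k) (≤-trans j<i i≤m)

-- Analytic sets

AgreeBelow-≤ : {rank : I → ℕ} {x y : I → A} {k m : ℕ} → k ≤ m → AgreeBelow rank m x y → AgreeBelow rank k x y
AgreeBelow-≤ k≤m agree i i<k = agree i (≤-trans i<k k≤m)

below-≈ : (rank : I → ℕ) (F : List I) → ∃[ k ] ({x y : I → A} → AgreeBelow rank k x y → x ≈[ F ] y)
below-≈ rank []      = 0 , λ _ → []
below-≈ rank (i ∷ F) = let k , h = below-≈ rank F in suc (rank i) ⊔ k ,
  λ agree → agree i (m≤m⊔n _ k) ∷ h (AgreeBelow-≤ {rank = rank} (m≤n⊔m (suc (rank i)) k) agree)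

continuous-≈ : {J : Set} {f : (I → A) → (J → B)} → Continuous f → ∀ x (G : List J) →
               Σ[ F ∈ List I ] (∀ y → x ≈[ F ] y → f x ≈[ G ] f y)
continuous-≈ cont x []      = [] , λ _ _ → []
continuous-≈ cont x (j ∷ G) =
  let F , h = cont x j ; F′ , h′ = continuous-≈ cont x G
  in F ++ F′ , λ y x≈y → h y (All.++⁻ˡ F x≈y) ∷ h′ y (All.++⁻ʳ F x≈y)

Analytic-preimage : {J : Set} {f : (I → A) → (J → B)} {E : Subset J B} →
                    Continuous f → Analytic E → Analytic (λ x → f x ∈ E)
Analytic-preimage {f = f} cont (C , closed , E⊆ , E⊇) = (λ x y → C (f x) y) , closed′ , E⊆ , E⊇
  where
  closed′ : Closed₂ (λ x y → C (f x) y)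
  closed′ x y ¬c = let F , G , h = closed (f x) y ¬c ; F′ , h′ = continuous-≈ cont x F
                   in F′ , G , λ x′ y′ x≈x′ y≈y′ → h (f x′) y′ (h′ x′ x≈x′) y≈y′

-- The numbers `2k` and `2k + 1`. One point of `ℕ ^ω` thus records a path and, for each `N`, a
-- position on it.
pack : ℕ → Dir → ℕ
pack zero    l = 0
pack zero    r = 1
pack (suc k) d = suc (suc (pack k d))

unpack : ℕ → Dir × ℕ
unpack 0             = l , 0
unpack 1             = r , 0
unpack (suc (suc k)) = let d , m = unpack k in d , suc m

unpack-pack : ∀ k d → unpack (pack k d) ≡ (d , k)
unpack-pack zero    l = refl
unpack-pack zero    r = refl
unpack-pack (suc k) d rewrite unpack-pack k d = refl

-- Trees that code sets of finite sequences

-- M s labels the node l^s₀·r·l^s₁·r⋯; nodes that do not end in r are labelled 0.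
-- The first argument counts the letters l read since the last r.
codeFrom : ℕ → (List ℕ → Fin 2) → Tree (Fin 2)
codeFrom a       M (l ∷ w) = codeFrom (suc a) M w
codeFrom a       M (r ∷ w) = codeFrom 0 (M ∘ (a ∷_)) w
codeFrom zero    M []      = M []
codeFrom (suc _) M []      = 0F

code : (List ℕ → Fin 2) → Tree (Fin 2)
code = codeFrom 0

-- Each entry of the sequence spelled out by a node uses up a letter `r`, so the sequence is no
-- longer than the node.
codeFrom-local : ∀ a {M M′} w → (∀ s → length s ≤ length w → M s ≡ M′ s) →
                 codeFrom a M w ≡ codeFrom a M′ w
codeFrom-local a       (l ∷ w) e = codeFrom-local (suc a) w (λ s s≤w → e s (m≤n⇒m≤1+n s≤w))
codeFrom-local a       (r ∷ w) e = codeFrom-local 0 w (λ s s≤w → e (a ∷ s) (s≤s s≤w))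
codeFrom-local zero    []      e = e [] z≤n
codeFrom-local (suc a) []      e = refl

Accepts-tail : ∀ t {δ d} → δ 0 ≡ d → Accepts t δ → Accepts (subtree [ d ] t) (δ ∘ suc)
Accepts-tail t refl acc N with acc (suc N)
... | suc k , s≤s N≤k , one = k , N≤k , one

-- Nodes that end in `l` carry 0, so an accepting path turns right at some point; `b` is the number
-- of letters `l` before that.
code-child : ∀ {M} → code M ∈ 𝓛 → ∃[ b ] code (M ∘ (b ∷_)) ∈ 𝓛
code-child {M} M∈𝓛 with to (𝓛⇔ (code M)) M∈𝓛
-- The 1 skips the root, which may be labelled 1 before any turn.
... | δ , acc with acc 1
... | suc k , _ , one = leave 0 k δ acc one
  where
  leave : ∀ a k δ → Accepts (codeFrom a M) δ → codeFrom a M (applyUpTo δ (suc k)) ≡ 1F →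
          ∃[ b ] code (M ∘ (b ∷_)) ∈ 𝓛
  leave a k δ acc one with δ 0 in eq
  leave a k       δ acc one | r =
    a , from (𝓛⇔ (code (M ∘ (a ∷_)))) (δ ∘ suc , Accepts-tail (codeFrom a M) eq acc)
  leave a (suc k) δ acc one | l = leave (suc a) k (δ ∘ suc) (Accepts-tail (codeFrom a M) eq acc) one

code-witness : ∀ a M w → codeFrom a M w ≡ 1F → ∃[ s ] M s ≡ 1F
code-witness a       M (l ∷ w) one = code-witness (suc a) M w one
code-witness a       M (r ∷ w) one = let s , e = code-witness 0 (M ∘ (a ∷_)) w one in a ∷ s , e
code-witness zero    M []      one = [] , one

-- Iterating `code-child` reads off `y`. After `k` blocks the remaining tree is still in `𝓛`, so it
-- has a node labelled 1, which supplies the extension `s` of the prefix.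
code-∈𝓛⇒ : ∀ M → code M ∈ 𝓛 → ∃[ y ] (∀ k → ∃[ s ] M (applyUpTo y k ++ s) ≡ 1F)
code-∈𝓛⇒ M M∈𝓛 = choices M M∈𝓛 , λ k →
  let u , _ , acc = stays k M M∈𝓛 ; m , _ , one = acc 0 
  in code-witness 0 (λ s → M (applyUpTo (choices M M∈𝓛) k ++ s)) (u m) one
  where
  choices : ∀ M → code M ∈ 𝓛 → ℕ → ℕ
  choices M h zero    = proj₁ (code-child h)
  choices M h (suc k) = choices _ (proj₂ (code-child h)) k

  stays : ∀ k M h → code (λ s → M (applyUpTo (choices M h) k ++ s)) ∈ 𝓛
  stays zero    M h = h
  stays (suc k) M h = stays k _ (proj₂ (code-child h))

-- The directions of the path l^a·r·l^(y 0)·r·l^(y 1)·r⋯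
directions : ℕ → (ℕ → ℕ) → ℕ → Dir
directions zero    y zero    = r
directions zero    y (suc m) = directions (y 0) (y ∘ suc) m
directions (suc a) y zero    = l
directions (suc a) y (suc m) = directions a y m

code-∈𝓛⇐ : ∀ M y → (∀ k → M (applyUpTo y k) ≡ 1F) → code M ∈ 𝓛
code-∈𝓛⇐ M y ones = from (𝓛⇔ (code M)) (along y , λ k →
  let m , k≤m , e = node k M y in m , k≤m , trans e (ones k))
  where
  along : (ℕ → ℕ) → ℕ → Dir
  along y = directions (y 0) (y ∘ suc)

  -- Within a block, `c` letters `l` have been read and `a` are to come; the `r` that follows makes
  -- `c + a` an entry.
  block : ∀ c a M y m → codeFrom c M (applyUpTo (directions a y) (suc a + m)) ≡
                        code (M ∘ ((c + a) ∷_)) (applyUpTo (along y) m)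
  block c zero    M y m rewrite +-identityʳ c = refl
  block c (suc a) M y m rewrite +-suc c a     = block (suc c) a M y m

  node : ∀ k M y → ∃[ m ] k ≤ m × code M (applyUpTo (along y) m) ≡ M (applyUpTo y k)
  node zero    M y = 0 , z≤n , refl
  node (suc k) M y =
    let m , k≤m , e = node k (M ∘ (y 0 ∷_)) (y ∘ suc)
    in suc (y 0 + m) , s≤s (≤-trans k≤m (m≤n+m m (y 0))) , trans (block 0 (y 0) M (y ∘ suc) m) e

prefix-agree : {y y′ : ℕ → A} {s : List A} (k m : ℕ) →
               applyUpTo y k ++ s ≡ applyUpTo y′ m → AgreeBelow id k y y′
prefix-agree (suc k) (suc m) e zero    _         = proj₁ (∷-injective e)
prefix-agree (suc k) (suc m) e (suc j) (s≤s j<k) = prefix-agree k m (proj₂ (∷-injective e)) j j<k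

indicator : {Q : Set} → Dec Q → Fin 2
indicator (yes _) = 1F
indicator (no _)  = 0F

indicator-yes : {Q : Set} (d : Dec Q) → Q → indicator d ≡ 1F
indicator-yes (yes _) q = refl
indicator-yes (no ¬q) q = contradiction q ¬q

indicator-1 : {Q : Set} (d : Dec Q) → indicator d ≡ 1F → Q
indicator-1 (yes q) _ = q

indicator-cong : {Q Q′ : Set} (d : Dec Q) (d′ : Dec Q′) → (Q → Q′) → (Q′ → Q) → indicator d ≡ indicator d′
indicator-cong (yes q) d′ f g = sym (indicator-yes d′ (f q))
indicator-cong (no ¬q) (yes q′) f g = contradiction (g q′) ¬q
indicator-cong (no ¬q) (no _) f g = refl

-- Completeness of `𝓛` for the analytic sets

module Coding (em : ExcludedMiddle 0ℓ) where

  -- The witness gives, besides a path, a position `mark y N` at or beyond `N` that carries a 1.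
  -- Naming the positions turns "infinitely often" into a closed condition.
  𝓛-analytic : Analytic 𝓛
  𝓛-analytic = C , closed , (λ {t} → ⊆C {t}) , λ {t} (y , c) →
      from (𝓛⇔ t) (δ y , λ N → let N≤m , one = c N in mark y N , N≤m , one)
    where
    δ : ℕ ^ω → ℕ → Dir
    δ y k = proj₁ (unpack (y k))

    mark : ℕ ^ω → ℕ → ℕ
    mark y k = proj₂ (unpack (y k))

    C : Tree (Fin 2) → ℕ ^ω → Set
    C t y = ∀ N → N ≤ mark y N × t (applyUpTo (δ y) (mark y N)) ≡ 1F

    ⊆C : ∀ {t} → t ∈ 𝓛 → ∃[ y ] C t y
    ⊆C {t} t∈𝓛 with to (𝓛⇔ t) t∈𝓛
    ... | ε , acc = y , λ N → let k , N≤k , one = acc N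
                                  mark≡ = cong proj₂ (unpack-pack k (ε N))
      in subst (N ≤_) (sym mark≡) N≤k ,
         trans (cong t (trans (cong (applyUpTo (δ y)) mark≡) (δ≡ k))) one
      where
      y : ℕ ^ω
      y k = pack (proj₁ (acc k)) (ε k)

      δ≡ : ∀ k → applyUpTo (δ y) k ≡ applyUpTo ε k
      δ≡ k = applyUpTo-cong k (λ j _ → cong proj₁ (unpack-pack (proj₁ (acc j)) (ε j)))

    closed : Closed₂ C
    closed t y ¬c with em {∃[ N ] ¬ (N ≤ mark y N × t (applyUpTo (δ y) (mark y N)) ≡ 1F)}
    ... | no none = contradiction holds ¬c
      where
      holds : C t y
      holds N with em {N ≤ mark y N × t (applyUpTo (δ y) (mark y N)) ≡ 1F}
      ... | yes c = c
      ... | no ¬c = contradiction (N , ¬c) none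
    -- A failure at `N` is visible from `y N`, the directions before `mark y N` and one label of the
    -- tree.
    ... | yes (N , ¬cN) = [ node ] , N ∷ upTo (mark y N) , λ where
        t′ y′ (t≡ ∷ []) (N≡ ∷ y≈) c′ →
          let N≤m , one = c′ N
              mark≡ = cong (proj₂ ∘ unpack) N≡
              path≡ = trans (applyUpTo-cong (mark y N)
                              (λ j j<m → cong (proj₁ ∘ unpack) (All.lookup y≈ (∈-upTo⁺ j<m))))
                            (cong (applyUpTo (δ y′)) mark≡)
          in ¬cN (subst (N ≤_) (sym mark≡) N≤m , trans t≡ (trans (cong t′ path≡) one))
      where
      node : Word
      node = applyUpTo (δ y) (mark y N)

  module _ {I A : Set} (rank : I → ℕ) where

    -- `C` is asked to hold at some nearby point, so that the answer depends only on the coordinates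
    -- of `x` of rank below `length s`.
    Meets : ((I → A) → ℕ ^ω → Set) → (I → A) → List ℕ → Set
    Meets C x s =
      ∃[ x′ ] ∃[ y′ ] C x′ y′ × AgreeBelow rank (length s) x x′ × s ≡ applyUpTo y′ (length s)

    marks : ((I → A) → ℕ ^ω → Set) → (I → A) → List ℕ → Fin 2
    marks C x s = indicator (em {Meets C x s})

    code-causal : (C : (I → A) → ℕ ^ω → Set) → Locality.OnTrees (causality rank) (code ∘ marks C)
    code-causal C w x y agree = codeFrom-local 0 w λ s s≤w →
      let agree′ = AgreeBelow-≤ {rank = rank} s≤w agree
      in indicator-cong em em
        (λ (x′ , y′ , c , e , p) → x′ , y′ , c , (λ i i<s → trans (sym (agree′ i i<s)) (e i i<s)) , p)
        (λ (x′ , y′ , c , e , p) → x′ , y′ , c , (λ i i<s → trans (agree′ i i<s) (e i i<s)) , p)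

    -- If `C x y` failed, closedness would give a neighbourhood of the pair that misses `C`; but a
    -- marked extension of a long enough prefix of `y` puts a point of `C` into it.
    code-projection : {C : (I → A) → ℕ ^ω → Set} → Closed₂ C →
                      ∀ x → (∃[ y ] C x y) ⇔ code (marks C x) ∈ 𝓛
    code-projection {C = C} closed x = mk⇔ ⇒ ⇐
      where
      ⇒ : ∃[ y ] C x y → code (marks C x) ∈ 𝓛
      ⇒ (y , c) = code-∈𝓛⇐ (marks C x) y λ k →
        indicator-yes em (x , y , c , (λ _ _ → refl) , cong (applyUpTo y) (sym (length-applyUpTo y k)))

      ⇐ : code (marks C x) ∈ 𝓛 → ∃[ y ] C x y
      ⇐ h with code-∈𝓛⇒ (marks C x) h
      ... | y , met with em {C x y}
      ... | yes c = y , c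
      ... | no ¬c =
        let F , G , apart = closed x y ¬c
            a , F≈ = below-≈ rank F
            b , G≈ = below-≈ id G
            k = a ⊔ b
            s , one = met k
            x′ , y′ , c , agree , p = indicator-1 em one
            k≤ = subst (k ≤_)
                   (sym (trans (length-++ (applyUpTo y k)) (cong (_+ length s) (length-applyUpTo y k))))
                   (m≤m+n k (length s))
        in contradiction c (apart x′ y′
             (F≈ (AgreeBelow-≤ {rank = rank} (≤-trans (m≤m⊔n a b) k≤) agree))
             (G≈ (AgreeBelow-≤ {rank = id} (m≤n⊔m a b) (prefix-agree k _ p))))

    analytic-code : {E : Subset I A} → Analytic E →
                    Σ[ t ∈ ((I → A) → Tree (Fin 2)) ]
                      Locality.OnTrees (causality rank) t × (∀ x → x ∈ E ⇔ t x ∈ 𝓛)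
    analytic-code (C , closed , E⊆ , E⊇) = code ∘ marks C , code-causal C , λ x →
      mk⇔ (λ e → to (code-projection closed x) (E⊆ e)) (λ h → E⊇ (from (code-projection closed x) h))

    analytic-codes : (η : Ord n) {S : Ord n → Subset I A} → (∀ θ → θ ≺ η → Analytic (S θ)) →
                     Σ[ t ∈ (Ord n → (I → A) → Tree (Fin 2)) ]
                       (∀ θ → Locality.OnTrees (causality rank) (t θ)) ×
                       (∀ θ → θ ≺ η → ∀ x → x ∈ S θ ⇔ t θ x ∈ 𝓛)
    analytic-codes η {S} analytic =
      proj₁ ∘ at , (λ θ → proj₁ (proj₂ (at θ))) , (λ θ → proj₂ (proj₂ (at θ)))
      where
      at : ∀ θ → Σ[ t ∈ ((I → A) → Tree (Fin 2)) ]
                   Locality.OnTrees (causality rank) t × (θ ≺ η → ∀ x → x ∈ S θ ⇔ t x ∈ 𝓛)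
      at θ with em {θ ≺ η}
      ... | yes θ≺η = let t , causal , e = analytic-code (analytic θ θ≺η) in t , causal , λ _ → e
      -- Nothing is known of `S θ` here; a constant tree keeps the whole family causal.
      ... | no  θ⊀η = (λ _ → blank) , (λ _ _ _ _ → refl) , λ θ≺η → contradiction θ≺η θ⊀η

-- Parity games along directions

module _ {i : MRIndex} where

  priorities : Tree (Letter i) → (ℕ → Dir) → ℕ → ℕ
  priorities t δ k = priority {i} (t (applyUpTo δ k))

  EvenLimsup : (ℕ → ℕ) → Set
  EvenLimsup s = ∃[ p ] IsLimsup s p × 2 ∣ p

  Follows : Tree (Letter i) → Strategy → (ℕ → Dir) → Set
  Follows t σ δ = ∀ k → player {i} (t (applyUpTo δ k)) ≡ Eve → δ k ≡ σ (applyUpTo δ k)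

  Winning : Tree (Letter i) → Strategy → Set
  Winning t σ = ∀ δ → Follows t σ δ → EvenLimsup (priorities t δ)

  W⇔ : ∀ t → t ∈ W i ⇔ ∃ (Winning t)
  W⇔ t = mk⇔
    (λ (σ , win) → σ , λ δ fol → win (applyUpTo δ) (directions-branch δ)
       λ k e → trans (sym (applyUpTo-∷ʳ δ k)) (cong (applyUpTo δ k ∷ʳ_) (fol k e)))
    (λ (σ , win) → σ , from′ σ win)
    where
    from′ : ∀ σ → Winning t σ → EveWinning {i} t σ
    from′ σ win v branch fol with branch-directions branch
    ... | δ , e = let p , lim , even = win δ fol′ in
        p , IsLimsup-cong (λ k → cong (priority {i} ∘ t) (sym (e k))) lim , even
      where
      fol′ : Follows t σ δ
      fol′ k eve = ∷ʳ-injectiveʳ (applyUpTo δ k) (applyUpTo δ k)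
        (trans (applyUpTo-∷ʳ δ k)
        (trans (sym (e (suc k)))
        (trans (fol k (trans (cong (player {i} ∘ t) (e k)) eve))
               (cong (λ w → w ∷ʳ σ w) (e k)))))

  W-resp : ∀ {t t′} → (∀ w → t w ≡ t′ w) → t ∈ W i → t′ ∈ W i
  W-resp {t} {t′} e (σ , win) = σ , λ v branch fol →
    let p , lim , even = win v branch (λ k eve → fol k (trans (cong (player {i}) (sym (e (v k)))) eve))
    in p , IsLimsup-cong (λ k → cong (priority {i}) (e (v k))) lim , even

  Follows-tail : ∀ t σ {δ d} → δ 0 ≡ d → Follows t σ δ → Follows (subtree [ d ] t) (σ ∘ (d ∷_)) (δ ∘ suc)
  Follows-tail t σ refl fol k = fol (suc k)

  EvenLimsup-tail : ∀ t {δ d} → δ 0 ≡ d →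
                    EvenLimsup (priorities (subtree [ d ] t) (δ ∘ suc)) → EvenLimsup (priorities t δ)
  EvenLimsup-tail t refl (p , lim , even) = p , IsLimsup-tail⁻ lim , even

  Winning-subtree : ∀ t σ d → (player {i} (t []) ≡ Eve → σ [] ≡ d) →
                    Winning t σ → Winning (subtree [ d ] t) (σ ∘ (d ∷_))
  Winning-subtree t σ d agrees win δ fol =
    let p , lim , even = win d∷δ fol′ in p , IsLimsup-tail⁺ lim , even
    where
    d∷δ : ℕ → Dir
    d∷δ zero    = d
    d∷δ (suc k) = δ k

    fol′ : Follows t σ d∷δ
    fol′ zero    eve = sym (agrees eve)
    fol′ (suc k) eve = fol k eve

  W-subtree⁻ : ∀ t d → player {i} (t []) ≡ Eve → subtree [ d ] t ∈ W i → t ∈ W i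
  W-subtree⁻ t d eve w with to (W⇔ (subtree [ d ] t)) w
  ... | σ , win = from (W⇔ t) (first , λ δ fol →
          EvenLimsup-tail t (fol 0 eve) (win (δ ∘ suc) (Follows-tail t first (fol 0 eve) fol)))
    where
    first : Strategy
    first []      = d
    first (_ ∷ w) = σ w

-- Players and their priorities

opponent : Player → Player
opponent Eve  = Adam
opponent Adam = Eve

Favours : Player → ℕ → Set
Favours Eve  p = 2 ∣ p
Favours Adam p = ¬ 2 ∣ p

-- Adam's side is the complement of `W i`; `Won-solo` and `Won-spine` show that in the games below
-- it behaves like a win for a player who makes the moves.
Won : {i : MRIndex} → Player → Pred (Tree (Letter i)) 0ℓ
Won {i} Eve  t = t ∈ W i
Won {i} Adam t = t ∉ W i

-- For each player a losing priority below a winning one, both in the range of the index.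
record Stakes (i : MRIndex) : Set where
  field
    stake      : Player → Fin 2 → Σ[ p ∈ ℕ ] toℕ (ι i) ≤ p × p ≤ κ i
    increasing : ∀ q → proj₁ (stake q 0F) ≤ proj₁ (stake q 1F)
    winning    : ∀ q → Favours q (proj₁ (stake q 1F))
    losing     : ∀ q → Favours (opponent q) (proj₁ (stake q 0F))

-- Games of naming an ordinal and proving membership

module Game (em : ExcludedMiddle 0ℓ) {i : MRIndex} (stakes : Stakes i) where

  open Stakes stakes

  height : Player → Fin 2 → ℕ
  height q b = proj₁ (stake q b)

  letter : Player → Fin 2 → Letter i
  letter q b = q , stake q b

  ≤-winning : ∀ q b → height q b ≤ height q 1F
  ≤-winning q 0F = increasing q
  ≤-winning q 1F = ≤-refl

  losing-≤ : ∀ q b → height q 0F ≤ height q b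
  losing-≤ q 0F = ≤-refl
  losing-≤ q 1F = increasing q

  limsup-winning : ∀ q {s : ℕ → Fin 2} → Frequently (λ k → s k ≡ 1F) → IsLimsup (height q ∘ s) (height q 1F)
  limsup-winning q {s} freq = (0 , λ k _ → ≤-winning q (s k)) ,
    λ N → let k , N≤k , one = freq N in k , N≤k , ≤-reflexive (cong (height q) (sym one))

  limsup-losing : ∀ q {s : ℕ → Fin 2} → ¬ Frequently (λ k → s k ≡ 1F) → IsLimsup (height q ∘ s) (height q 0F)
  limsup-losing q {s} rare = eventually , λ N → N , ≤-refl , losing-≤ q (s N)
    where
    zero≤ : ∀ {b} → b ≢ 1F → height q b ≤ height q 0F
    zero≤ {0F} _   = ≤-refl
    zero≤ {1F} b≢1 = contradiction refl b≢1

    eventually : ∃[ N ] (∀ k → N ≤ k → height q (s k) ≤ height q 0F)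
    eventually with em {∃[ N ] (∀ k → N ≤ k → s k ≢ 1F)}
    ... | yes (N , none) = N , λ k N≤k → zero≤ (none k N≤k)
    ... | no ¬ev = contradiction freq rare
      where
      freq : Frequently (λ k → s k ≡ 1F)
      freq N with em {∃[ k ] N ≤ k × s k ≡ 1F}
      ... | yes hit  = hit
      ... | no  ¬hit = contradiction (N , λ k N≤k one → ¬hit (k , N≤k , one)) ¬ev

  Won-opponent : ∀ q {t : Tree (Letter i)} → Won {i} (opponent q) t ⇔ (¬ Won {i} q t)
  Won-opponent Eve      = mk⇔ (λ x → x) (λ x → x)
  Won-opponent Adam {t} = mk⇔ (λ w ¬w → ¬w w) stable
    where
    stable : ¬ ¬ (t ∈ W i) → t ∈ W i
    stable ¬¬w with em {t ∈ W i}
    ... | yes w = w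
    ... | no ¬w = contradiction ¬w ¬¬w

  Won-resp : ∀ q {t t′ : Tree (Letter i)} → (∀ w → t w ≡ t′ w) → Won {i} q t → Won {i} q t′
  Won-resp Eve  e w    = W-resp {i} e w
  Won-resp Adam e ¬w w = ¬w (W-resp {i} (λ v → sym (e v)) w)

  solo : Player → Tree (Fin 2) → Tree (Letter i)
  solo q t w = letter q (t w)

  -- Player `q` makes all the moves, so a play is a path chosen by `q`, and its limsup is the
  -- winning stake iff 1 recurs on it.
  Won-solo : ∀ q t → Won {i} q (solo q t) ⇔ t ∈ 𝓛
  Won-solo Eve t = mk⇔ ⇒ ⇐
    where
    ⇒ : solo Eve t ∈ W i → t ∈ 𝓛
    ⇒ (σ , win) with em {Frequently (λ k → t (play k) ≡ 1F)}
      where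
      play : ℕ → Word
      play zero    = []
      play (suc k) = play k ∷ʳ σ (play k)
    ... | yes freq = _ , snoc-branch _ refl (λ _ → refl) , freq
    ... | no  rare = let p , lim , even = win _ (snoc-branch _ refl (λ _ → refl)) (λ _ _ → refl) in
      contradiction (subst (2 ∣_) (IsLimsup-unique lim (limsup-losing Eve rare)) even) (losing Eve)

    ⇐ : t ∈ 𝓛 → solo Eve t ∈ W i
    ⇐ t∈𝓛 with to (𝓛⇔ t) t∈𝓛
    ... | δ , acc = from (W⇔ {i} (solo Eve t)) (δ ∘ length , λ δ′ fol →
      let same : ∀ k → applyUpTo δ k ≡ applyUpTo δ′ k
          same k = applyUpTo-cong k (λ j _ → sym (trans (fol j refl) (cong δ (length-applyUpTo δ′ j))))
      in height Eve 1F ,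
         IsLimsup-cong (λ k → cong (height Eve ∘ t) (same k)) (limsup-winning Eve acc) ,
         winning Eve)
  Won-solo Adam t = mk⇔ ⇒ ⇐
    where
    ⇒ : solo Adam t ∉ W i → t ∈ 𝓛
    ⇒ lost with em {t ∈ 𝓛}
    ... | yes t∈𝓛 = t∈𝓛
    ... | no  t∉𝓛 = contradiction
      -- No node belongs to Eve, so her strategy is a mere default.
      ((λ _ → l) , λ v branch _ →
        height Adam 0F , limsup-losing Adam (λ freq → t∉𝓛 (v , branch , freq)) , losing Adam) lost

    ⇐ : t ∈ 𝓛 → solo Adam t ∉ W i
    ⇐ (u , branch , acc) (σ , win) with win u branch (λ _ ())
    ... | p , lim , even =
      winning Adam (subst (2 ∣_) (IsLimsup-unique lim (limsup-winning Adam acc)) even)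

  lefts : ℕ → Dir
  lefts _ = l

  spine-lefts : (a : A) (f : ℕ → Tree A) (k : ℕ) → spine a f (applyUpTo lefts k) ≡ a
  spine-lefts a f zero    = refl
  spine-lefts a f (suc k) = spine-lefts a (f ∘ suc) k

  limsup-lefts : ∀ q f → IsLimsup (priorities {i} (spine (letter q 0F) f) lefts) (height q 0F)
  limsup-lefts q f = IsLimsup-cong (λ k → cong (priority {i}) (sym (spine-lefts (letter q 0F) f k)))
    ((0 , λ _ _ → ≤-refl) , λ N → N , ≤-refl , ≤-refl)

  turn : ∀ {d} → d ≢ r → d ≡ l
  turn {l} _   = refl
  turn {r} d≢r = contradiction refl d≢r

  -- Never leaving the spine yields the losing stake forever, so `q` has to turn right at some `k`,
  -- and `f k` decides the game.
  Won-spine : ∀ q f → Won {i} q (spine (letter q 0F) f) ⇔ (∃[ k ] Won {i} q (f k))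
  Won-spine Eve f = mk⇔ ⇒ (λ (k , w) → ⇐ k f w)
    where
    ⇐ : ∀ k f → f k ∈ W i → spine (letter Eve 0F) f ∈ W i
    ⇐ zero    f w = W-subtree⁻ {i} (spine (letter Eve 0F) f) r refl w
    ⇐ (suc k) f w = W-subtree⁻ {i} (spine (letter Eve 0F) f) l refl (⇐ k (f ∘ suc) w)

    search : ∀ k f σ → Winning {i} (spine (letter Eve 0F) f) σ → σ (applyUpTo lefts k) ≡ r → ∃[ j ] f j ∈ W i
    search zero    f σ win e = 0 , from (W⇔ {i} (f 0))
      (σ ∘ (r ∷_) , Winning-subtree {i} (spine (letter Eve 0F) f) σ r (λ _ → e) win)
    search (suc k) f σ win e with σ [] in eq
    ... | r = 0 , from (W⇔ {i} (f 0))
      (σ ∘ (r ∷_) , Winning-subtree {i} (spine (letter Eve 0F) f) σ r (λ _ → eq) win)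
    ... | l = let j , w = search k (f ∘ suc) (σ ∘ (l ∷_))
                            (Winning-subtree {i} (spine (letter Eve 0F) f) σ l (λ _ → eq) win) e
              in suc j , w

    ⇒ : spine (letter Eve 0F) f ∈ W i → ∃[ k ] f k ∈ W i
    ⇒ w with to (W⇔ {i} (spine (letter Eve 0F) f)) w
    ... | σ , win with em {∃[ k ] σ (applyUpTo lefts k) ≡ r}
    ... | yes (k , e) = search k f σ win e
    ... | no never = let p , lim , even = win lefts (λ k _ → sym (turn (λ e → never (k , e)))) in
      contradiction (subst (2 ∣_) (IsLimsup-unique lim (limsup-lefts Eve f)) even) (losing Eve)
  Won-spine Adam f = mk⇔ ⇒ (λ (k , lost) w → lost (⇐ k f w))
    where
    ⇐ : ∀ k f → spine (letter Adam 0F) f ∈ W i → f k ∈ W i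
    ⇐ k f w = let σ , win = to (W⇔ {i} (spine (letter Adam 0F) f)) w in from (W⇔ {i} (f k)) (go k f σ win)
      where
      go : ∀ k f σ → Winning {i} (spine (letter Adam 0F) f) σ → ∃ (Winning {i} (f k))
      go zero    f σ win = σ ∘ (r ∷_) , Winning-subtree {i} (spine (letter Adam 0F) f) σ r (λ ()) win
      go (suc k) f σ win = go k (f ∘ suc) (σ ∘ (l ∷_))
        (Winning-subtree {i} (spine (letter Adam 0F) f) σ l (λ ()) win)

    -- `spine l σs` plays `σs j` once Adam has entered `f j`; its value `l` on the spine is a
    -- default. The given right turn at `k` bounds the search for the first one.
    combine : ∀ k f (σs : ℕ → Strategy) → (∀ j → Winning {i} (f j) (σs j)) →
              ∀ δ → Follows {i} (spine (letter Adam 0F) f) (spine l σs) δ → δ k ≡ r →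
              EvenLimsup {i} (priorities {i} (spine (letter Adam 0F) f) δ)
    combine k f σs wins δ fol e with δ 0 in eq
    combine k f σs wins δ fol e | r = EvenLimsup-tail {i} (spine (letter Adam 0F) f) eq
      (wins 0 (δ ∘ suc) (Follows-tail {i} (spine (letter Adam 0F) f) (spine l σs) eq fol))
    combine zero    f σs wins δ fol e | l with trans (sym eq) e
    ... | ()
    combine (suc k) f σs wins δ fol e | l = EvenLimsup-tail {i} (spine (letter Adam 0F) f) eq
      (combine k (f ∘ suc) (σs ∘ suc) (wins ∘ suc) (δ ∘ suc)
        (Follows-tail {i} (spine (letter Adam 0F) f) (spine l σs) eq fol) e)

    all-won : (∀ k → f k ∈ W i) → spine (letter Adam 0F) f ∈ W i
    all-won ws = from (W⇔ {i} (spine (letter Adam 0F) f)) (spine l σs , wins)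
      where
      σs : ℕ → Strategy
      σs k = proj₁ (to (W⇔ {i} (f k)) (ws k))

      wins : Winning {i} (spine (letter Adam 0F) f) (spine l σs)
      wins δ fol with em {∃[ k ] δ k ≡ r}
      ... | yes (k , e) = combine k f σs (λ j → proj₂ (to (W⇔ {i} (f j)) (ws j))) δ fol e
      ... | no never = height Adam 0F ,
        IsLimsup-cong (λ k → cong (priority {i} ∘ spine (letter Adam 0F) f)
                             (applyUpTo-cong k (λ j _ → sym (turn (λ e → never (j , e))))))
          (limsup-lefts Adam f) ,
        losing Adam

    ⇒ : spine (letter Adam 0F) f ∉ W i → ∃[ k ] f k ∉ W i
    ⇒ lost with em {∃[ k ] f k ∉ W i}
    ... | yes found = found
    ... | no  none  = contradiction
      (all-won λ k → from (Won-opponent Adam {f k}) (λ ¬w → none (k , ¬w))) lost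

  Won-fan : ∀ q (f : Ord n → Tree (Letter i)) → Won {i} q (fan (letter q 0F) f) ⇔ (∃[ θ ] Won {i} q (f θ))
  Won-fan {zero} q f = mk⇔ (λ w → [] , w) λ { ([] , w) → w }
  Won-fan {suc n} q f = mk⇔
    (λ w → let k , w′ = to (Won-spine q _) w ; θ , w″ = to (Won-fan q (f ∘ (k ∷_))) w′ in k ∷ θ , w″)
    λ { (k ∷ θ , w) → from (Won-spine q _) (k , from (Won-fan q (f ∘ (k ∷_))) (θ , w)) }

  Won-unless : ∀ q {t : Tree (Letter i)} → ¬ Won {i} (opponent q) t → Won {i} q t
  Won-unless q {t} ¬w with em {Won {i} q t}
  ... | yes w  = w
  ... | no  ¬v = contradiction (from (Won-opponent q) ¬v) ¬w

  Won-spine-opponent : ∀ q f → Won {i} q (spine (letter (opponent q) 0F) f) ⇔ (∀ k → Won {i} q (f k))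
  Won-spine-opponent q f = mk⇔
    (λ w k → Won-unless q λ ¬w → to (Won-opponent q) (from (Won-spine (opponent q) f) (k , ¬w)) w)
    (λ ws → Won-unless q λ ¬w →
      let k , ¬wk = to (Won-spine (opponent q) f) ¬w in to (Won-opponent q) ¬wk (ws k))

  -- This is `Won-fan` read through `Won-solo`: giving all nodes of a fan labelled 0 to Eve makes it
  -- a fan with her losing letter.
  fan-𝓛 : (t : Ord n → Tree (Fin 2)) → fan 0F t ∈ 𝓛 ⇔ (∃[ θ ] t θ ∈ 𝓛)
  fan-𝓛 t = mk⇔
    (λ w → let θ , wθ = to (Won-fan Eve (solo Eve ∘ t)) (Won-resp Eve same (from (Won-solo Eve (fan 0F t)) w))
           in θ , to (Won-solo Eve (t θ)) wθ)
    (λ (θ , wθ) → to (Won-solo Eve (fan 0F t)) (Won-resp Eve (λ v → sym (same v))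
                    (from (Won-fan Eve (solo Eve ∘ t)) (θ , from (Won-solo Eve (t θ)) wθ))))
    where
    same : ∀ w → solo Eve (fan 0F t) w ≡ fan (letter Eve 0F) (solo Eve ∘ t) w
    same = fan-cong (letter Eve) 0F {f = t} (λ _ _ → refl)

  -- q names θ; the opponent lets q prove t θ ∈ 𝓛, or refutes the minimality of θ by
  -- naming θ′ ≺ θ and proving t θ′ ∈ 𝓛.
  module _ (q : Player) (G : Pred (Ord n) 0ℓ) where

    replies : (Ord n → Tree (Fin 2)) → Ord n → ℕ → Tree (Letter i)
    replies t θ zero    = solo q (t θ when em {G θ})
    -- There are two challenges but infinitely many exits, so all later exits repeat the second
    -- challenge.
    replies t θ (suc _) = fan (letter (opponent q) 0F) λ θ′ → solo (opponent q) (t θ′ when em {θ′ ≺ θ})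

    duel : (Ord n → Tree (Fin 2)) → Tree (Letter i)
    duel t = fan (letter q 0F) λ θ → spine (letter (opponent q) 0F) (replies t θ)

    -- The named `θ` survives exit 0 iff it is in `G` with `t θ ∈ 𝓛`, and the other exits iff no
    -- smaller index has its tree in `𝓛`.
    Won-duel : ∀ t → Won {i} q (duel t) ⇔ First G (λ θ → t θ ∈ 𝓛)
    Won-duel t = mk⇔ ⇒ ⇐
      where
      refute : ∀ θ → Tree (Letter i)
      refute θ = replies t θ 1

      ⇒ : Won {i} q (duel t) → First G (λ θ → t θ ∈ 𝓛)
      ⇒ w =
        let θ , w′ = to (Won-fan q _) w
            all    = to (Won-spine-opponent q _) w′
            g , ok = to (when-𝓛 em) (to (Won-solo q _) (all 0))
        in θ , g , ok , λ θ′ θ′≺θ hit →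
           to (Won-opponent q) (from (Won-fan (opponent q) _)
             (θ′ , from (Won-solo (opponent q) _) (from (when-𝓛 em) (θ′≺θ , hit)))) (all 1)

      ⇐ : First G (λ θ → t θ ∈ 𝓛) → Won {i} q (duel t)
      ⇐ (θ , g , ok , least) = from (Won-fan q _) (θ , from (Won-spine-opponent q _) λ where
        zero    → from (Won-solo q _) (from (when-𝓛 em) (g , ok))
        (suc _) → Won-unless q λ w →
          let θ′ , w′     = to (Won-fan (opponent q) _) w
              θ′≺θ , hit = to (when-𝓛 em) (to (Won-solo (opponent q) _) w′)
          in least θ′ θ′≺θ hit)

    module _ {X : Set} (L : Locality X) where
      open Locality L

      -- The side conditions concern indices only and not the point of `X`, so deciding them
      -- preserves locality.
      duel-local : {t : X → Ord n → Tree (Fin 2)} → (∀ θ → OnTrees (λ x → t x θ)) → OnTrees (duel ∘ t)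
      duel-local {t} h = fan-local λ θ → spine-local λ where
        zero    → λ w → map (letter q) (when-local em (h θ) w)
        (suc _) → fan-local λ θ′ w → map (letter (opponent q)) (when-local em (h θ′) w)

-- Ordinals below ω^n

≺-trans : {θ θ′ θ″ : Ord n} → θ ≺ θ′ → θ′ ≺ θ″ → θ ≺ θ″
≺-trans = Lex.<-trans (IsEquivalence.isPartialEquivalence ≡-isEquivalence) <-resp₂-≡ <-trans

-- With `≺ω^`, this identifies the ordinals below `ω^ n` with `Ord n`, by a leading coefficient 0.
0∷≺ω^ : (θ : Ord n) → 0 ∷ θ ≺ ω^ n
0∷≺ω^ θ = this z<s refl

∷≺0∷ : ∀ {a} {θ θ′ : Ord n} → a ∷ θ ≺ 0 ∷ θ′ → a ≡ 0 × θ ≺ θ′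
∷≺0∷ (next e θ≺θ′) = e , θ≺θ′

⊀zero : {θ : Ord n} → ¬ θ ≺ Vec.replicate n 0
⊀zero {suc n} (next _ θ≺0) = ⊀zero θ≺0
⊀zero {zero}  (base ())

≺ω^ : ∀ {a} {θ : Ord n} → a ∷ θ ≺ ω^ n → a ≡ 0
≺ω^ (this (s≤s z≤n) _) = refl
≺ω^ (next _ θ≺0)       = contradiction θ≺0 ⊀zero

ordParity-zero : ∀ n → ordParity (Vec.replicate n 0) ≡ 0ℙ
ordParity-zero zero          = refl
ordParity-zero (suc zero)    = refl
ordParity-zero (suc (suc n)) = ordParity-zero (suc n)

-- The ordinal `ω^ (suc n)` is a limit, hence even, so the parity asked for is odd; the leading 0
-- does not affect it.
Diff-ω^ : (S : Ord (suc (suc n)) → Subset I A) → ∀ x →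
          x ∈ Diff (ω^ (suc n)) S ⇔ First Odd (λ θ → x ∈ S (0 ∷ θ))
Diff-ω^ {n = n} S x = mk⇔ ⇒ ⇐
  where
  parity-ω^ : ordParity (ω^ (suc n)) ⁻¹ ≡ 1ℙ
  parity-ω^ = cong _⁻¹ (ordParity-zero (suc n))

  ⇒ : x ∈ Diff (ω^ (suc n)) S → First Odd (λ θ → x ∈ S (0 ∷ θ))
  ⇒ (a ∷ θ@(_ ∷ _) , θ≺ω , odd , x∈S , least) with ≺ω^ θ≺ω
  ... | refl = θ , trans odd parity-ω^ , x∈S , λ θ′ θ′≺θ → least (0 ∷ θ′) (next refl θ′≺θ)

  ⇐ : First Odd (λ θ → x ∈ S (0 ∷ θ)) → x ∈ Diff (ω^ (suc n)) S
  ⇐ (θ@(_ ∷ _) , odd , x∈S , least) =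
    0 ∷ θ , 0∷≺ω^ θ , trans odd (sym parity-ω^) , x∈S , λ where
      (a ∷ θ′) lt → let a≡0 , θ′≺θ = ∷≺0∷ lt in subst (λ a → x ∉ S (a ∷ θ′)) (sym a≡0) (least θ′ θ′≺θ)

-- Completeness of `𝓛[ n ]`, reduction to `W i`, and the diagonal argument

module Reductions (em : ExcludedMiddle 0ℓ) {i : MRIndex} (stakes : Stakes i) where

  open Coding em
  open Game em stakes

  subtrees : Tree A → Ord n → Tree A
  subtrees t θ = subtree (address θ) t

  fan-subtree : (t : Ord n → Tree (Fin 2)) (θ : Ord n) → subtree (address θ) (fan 0F t) ∈ 𝓛 ⇔ t θ ∈ 𝓛
  fan-subtree t θ = mk⇔ (𝓛-resp (fan-address 0F t θ)) (𝓛-resp (λ v → sym (fan-address 0F t θ v)))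

  module _ {n : ℕ} where

    -- A tree coding `x ∈ S (0 ∷ θ)` is hung below `address θ`, so both sides test the same least
    -- index for oddness.
    D⇒≤W : {E : Subset ℕ A} → D (ω^ (suc n)) E → E ≤W 𝓛[ suc n ]
    D⇒≤W {E = E} (S , analytic , _ , E⊆ , E⊇) with analytic-codes id (ω^ (suc n)) analytic
    ... | t , causal , codes = f ,
          causal⇒continuous (Locality.fan-local (causality id) (λ θ → causal (0 ∷ θ))) ,
          (λ {x} e → let θ , odd , x∈S , least = to (Diff-ω^ S x) (E⊆ e)
                     in θ , (to (member x θ) x∈S , odd) , λ θ′ lt h → least θ′ lt (from (member x θ′) h)) ,
          (λ {x} (θ , (h , odd) , least) → E⊇ (from (Diff-ω^ S x)
             (θ , odd , from (member x θ) h , λ θ′ lt x∈S → least θ′ lt (to (member x θ′) x∈S))))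
      where
      f : (ℕ → _) → Tree (Fin 2)
      f x = fan 0F (λ (θ : Ord (suc n)) → t (0 ∷ θ) x)

      member : ∀ x θ → x ∈ S (0 ∷ θ) ⇔ subtree (address θ) (f x) ∈ 𝓛
      member x θ = let c = codes (0 ∷ θ) (0∷≺ω^ θ) x ; s = fan-subtree (λ θ → t (0 ∷ θ) x) θ
                   in mk⇔ (from s ∘ to c) (from c ∘ to s)

    -- Admitting all indices up to `θ` makes the sets increase with `θ`, as `D` demands, without
    -- changing the least index.
    cut : Ord (suc n) → Tree (Fin 2) → Ord (suc n) → Tree (Fin 2)
    cut θ t θ′ = subtrees t θ′ when em {θ′ ≡ θ ⊎ θ′ ≺ θ}

    fan-cut : ∀ θ t → fan 0F (cut θ t) ∈ 𝓛 ⇔ (∃[ θ′ ] (θ′ ≡ θ ⊎ θ′ ≺ θ) × subtrees t θ′ ∈ 𝓛)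
    fan-cut θ t = mk⇔
      (λ h → let θ′ , h′ = to (fan-𝓛 (cut θ t)) h in θ′ , to (when-𝓛 {t = subtrees t θ′} em) h′)
      (λ (θ′ , h) → from (fan-𝓛 (cut θ t)) (θ′ , from (when-𝓛 {t = subtrees t θ′} em) h))

    -- One fan gathers the subtrees up to `θ`, so a union of preimages of `𝓛` becomes a single
    -- continuous preimage, which is analytic.
    ≤W⇒D : {E : Subset ℕ A} → E ≤W 𝓛[ suc n ] → D (ω^ (suc n)) E
    ≤W⇒D {A} {E} (f , cont , E⊆ , E⊇) = S , (λ { (a ∷ θ) _ → analytic θ }) , mono ,
        (λ {x} e → from (Diff-ω^ S x) (⇒ x (E⊆ e))) , (λ {x} d → E⊇ (⇐ x (to (Diff-ω^ S x) d)))
      where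
      S : Ord (suc (suc n)) → Subset ℕ A
      S (_ ∷ θ) x = fan 0F (cut θ (f x)) ∈ 𝓛

      analytic : ∀ θ → Analytic (λ x → fan 0F (cut θ (f x)) ∈ 𝓛)
      analytic θ = Analytic-preimage
        (λ x w → Locality.fan-local continuity {f = λ x → cut θ (f x)}
          (λ θ′ → Locality.when-local continuity {t = λ x → subtrees (f x) θ′} em
            (λ v x → cont x (address θ′ ++ v))) w x)
        𝓛-analytic

      mono : ∀ θ θ′ → θ ≺ ω^ (suc n) → θ′ ≺ θ → S θ′ ⊆ S θ
      mono (a ∷ θ) (a′ ∷ θ′) θ≺ω lt {x} h with ≺ω^ θ≺ω
      ... | refl = let _ , θ′≺θ = ∷≺0∷ lt ; θ″ , θ″≤θ′ , h′ = to (fan-cut θ′ (f x)) h in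
        from (fan-cut θ (f x)) (θ″ , inj₂ (below θ″≤θ′ θ′≺θ) , h′)
        where
        below : ∀ {θ″ θ′ θ : Ord (suc n)} → θ″ ≡ θ′ ⊎ θ″ ≺ θ′ → θ′ ≺ θ → θ″ ≺ θ
        below (inj₁ refl) lt = lt
        below (inj₂ lt′)  lt = ≺-trans lt′ lt

      ⇒ : ∀ x → f x ∈ 𝓛[ suc n ] → First Odd (λ θ → x ∈ S (0 ∷ θ))
      ⇒ x (θ , (h , odd) , least) =
        θ , odd , from (fan-cut θ (f x)) (θ , inj₁ refl , h) , λ θ′ θ′≺θ h′ →
          case to (fan-cut θ′ (f x)) h′ of λ where
            (θ″ , inj₁ refl , h″) → least θ″ θ′≺θ h″
            (θ″ , inj₂ lt   , h″) → least θ″ (≺-trans lt θ′≺θ) h″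

      ⇐ : ∀ x → First Odd (λ θ → x ∈ S (0 ∷ θ)) → f x ∈ 𝓛[ suc n ]
      ⇐ x (θ , odd , h , least) = case to (fan-cut θ (f x)) h of λ where
          (_  , inj₁ refl , h′) → θ , (h′ , odd) , λ θ′ lt h″ → least θ′ lt (reached θ′ h″)
          (θ′ , inj₂ lt   , h′) → contradiction (reached θ′ h′) (least θ′ lt)
        where
        reached : ∀ θ′ → subtrees (f x) θ′ ∈ 𝓛 → x ∈ S (0 ∷ θ′)
        reached θ′ h = from (fan-cut θ′ (f x)) (θ′ , inj₁ refl , h)

  𝓛≤W : ∀ n → 𝓛[ n ] ≤W W i
  𝓛≤W n = f ,
    (λ t w → duel-local Eve (Odd {n}) continuity
      (λ θ w t → [ address θ ++ w ] , λ { t′ (e ∷ []) → e }) w t) ,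
    (λ {t} (θ , (h , p) , least) → from (Won-duel Eve (Odd {n}) (subtrees t)) (θ , p , h , least)) ,
    (λ {t} w → let θ , p , h , least = to (Won-duel Eve (Odd {n}) (subtrees t)) w in θ , (h , p) , least)
    where
    f : Tree (Fin 2) → Tree (Letter i)
    f t = duel Eve (Odd {n}) (subtrees t)

  -- Were W i the difference of the S θ, a tree t that codes the game "Adam proves that
  -- t lies in that difference" would be a win for Eve iff it is not.
  W∉D : (α : Ord n) → ¬ D α (W i)
  W∉D {n} α (S , analytic , _ , W⊆ , W⊇) with analytic-codes length α analytic
  ... | codes , causal , member = t∉W (W⊇ (to Φ-won (λ w → t∉W (W-resp {i} (λ v → sym (fixed v)) w))))
    where
    G : Pred (Ord n) 0ℓ
    G θ = θ ≺ α × ordParity θ ≡ ordParity α ⁻¹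

    Φ : Tree (Letter i) → Tree (Letter i)
    Φ t = duel Adam G (λ θ → codes θ t)

    fixpoint : ∃[ t ] (∀ w → t w ≡ Φ t w)
    fixpoint = causal-fixpoint length Φ (λ _ → letter Eve 0F)
      (λ x y w → duel-local Adam G (causality length) causal w x y)

    t : Tree (Letter i)
    t = proj₁ fixpoint

    fixed : ∀ w → t w ≡ Φ t w
    fixed = proj₂ fixpoint

    Φ-won : Φ t ∉ W i ⇔ t ∈ Diff α S
    Φ-won = mk⇔
      (λ lost → let θ , (θ≺α , p) , h , least = to (Won-duel Adam G _) lost in
        θ , θ≺α , p , from (member θ θ≺α t) h ,
        λ θ′ lt t∈S → least θ′ lt (to (member θ′ (≺-trans lt θ≺α) t) t∈S))
      (λ (θ , θ≺α , p , t∈S , least) → from (Won-duel Adam G _)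
        (θ , (θ≺α , p) , to (member θ θ≺α t) t∈S ,
         λ θ′ lt h → least θ′ lt (from (member θ′ (≺-trans lt θ≺α) t) h)))

    t∉W : t ∉ W i
    -- If Eve won `t`, then `t` would lie in the difference, so Adam would win `Φ t`, which has the
    -- same labels as `t`.
    t∉W w = from Φ-won (W⊆ w) (W-resp {i} fixed w)

-- Choice of priorities and conclusion

Stakes-of : (i : MRIndex) → ⟨0,2⟩ ⊑ i ⊎ i ≡ ⟨1,3⟩ → Stakes i
Stakes-of (index 0F κ _) (inj₁ (inj₁ (_ , 2≤κ))) = record
  -- Each player gets two adjacent priorities, the larger one good for that player: among 0, 1, 2
  -- here and among 1, 2, 3 when `ι` is 1.
  { stake      = λ { Eve  0F → 1 , z≤n , ≤-trans (s≤s z≤n) 2≤κ ; Eve  1F → 2 , z≤n , 2≤κ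
                   ; Adam 0F → 0 , z≤n , z≤n ; Adam 1F → 1 , z≤n , ≤-trans (s≤s z≤n) 2≤κ }
  ; increasing = λ { Eve → s≤s z≤n ; Adam → z≤n }
  ; winning    = λ { Eve → ∣-refl ; Adam → from-no (2 ∣? 1) }
  ; losing     = λ { Eve → from-no (2 ∣? 1) ; Adam → 2 ∣0 }
  }
Stakes-of (index 0F κ _) (inj₁ (inj₂ (_ , () , _)))
Stakes-of (index 0F κ _) (inj₂ ())
Stakes-of (index 1F κ ι≤κ) h = record
  { stake      = λ { Eve  0F → 1 , ≤-refl , ≤-trans (s≤s z≤n) 3≤κ
                   ; Eve  1F → 2 , s≤s z≤n , ≤-trans (s≤s (s≤s z≤n)) 3≤κ
                   ; Adam 0F → 2 , s≤s z≤n , ≤-trans (s≤s (s≤s z≤n)) 3≤κ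
                   ; Adam 1F → 3 , s≤s z≤n , 3≤κ }
  ; increasing = λ { Eve → s≤s z≤n ; Adam → s≤s (s≤s z≤n) }
  ; winning    = λ { Eve → ∣-refl ; Adam → from-no (2 ∣? 3) }
  ; losing     = λ { Eve → from-no (2 ∣? 1) ; Adam → ∣-refl }
  }
  where
  κ-bound : ⟨0,2⟩ ⊑ index 1F κ ι≤κ ⊎ index 1F κ ι≤κ ≡ ⟨1,3⟩ → 3 ≤ κ
  κ-bound (inj₁ (inj₁ (() , _)))
  -- With `ι` equal to 1 the order starts at `κ` equal to 4; the value 3 comes only from the dual
  -- index.
  κ-bound (inj₁ (inj₂ (_ , _ , 4≤κ))) = <⇒≤ 4≤κ
  κ-bound (inj₂ refl)                 = ≤-refl

  3≤κ : 3 ≤ κ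
  3≤κ = κ-bound h

theorem5p10 : ExcludedMiddle 0ℓ →
    (i : MRIndex) → ⟨0,2⟩ ⊑ i ⊎ i ≡ ⟨1,3⟩ →
    (∀ (n : ℕ) → 1 ≤ n → D-Complete (ω^ n) 𝓛[ n ] × 𝓛[ n ] ≤W W i)
    × (∀ (n : ℕ) (α : Ord n) → ¬ D α (W i))
theorem5p10 em i h =
  (λ { (suc n) _ → (λ _ _ _ _ → mk⇔ D⇒≤W ≤W⇒D) , 𝓛≤W (suc n) }) , λ _ → W∉D
  where open Reductions em (Stakes-of i h)
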